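{- Let $\mathcal{L}=\langle S, Act_\tau,\to\rangle$ be a finite-branching labelled transition system of processes, and let $\mathcal{T}=\langle T,Act_\tau\cup\{\omega\},\to\rangle$ be a labelled transition system of tests with finitely many states in which every state has only finitely many outgoing transitions. Then every test $t\in T$ is may-representable: there exists a (closed) formula $\phi\in\mathrm{recHML}$ such that for every $p\in S$, $p\ \mathbf{may\ satisfy}\ t$ if and only if $p\in[\![\phi]\!]$.
   Context: **Labelled transition systems.** An LTS over a countable set $Act$ of external actions is a triple $\langle S,Act_\tau,\to\rangle$ with $S$ a countable set of states (processes), $Act_\tau=Act\cup\{\tau\}$ where $\tau\notin Act$, and $\to\subseteq S\times Act_\tau\times S$; write $s\xrightarrow{\alpha}s'$ for $(s,\alpha,s')\in\to$, and $s\xrightarrow{\alpha}$ if such an $s'$ exists. The letter $a$ ranges over $Act$, $\alpha$ over $Act_\tau$. $\mathrm{Succ}(s)=\{s' : s\xrightarrow{\alpha}s'\text{ for some }\alpha\in Act_\tau\}$; the LTS of processes is finite branching if $\mathrm{Succ}(s)$ is finite for all $s\in S$. $s\Uparrow$ (diverges) if there is an infinite path $s\xrightarrow{\tau}s_1\xrightarrow{\tau}\cdots$; otherwise $s\Downarrow$ (converges). Weak transitions: $\stackrel{\tau}{\Rightarrow}$ is the reflexive transitive closure of $\xrightarrow{\tau}$, and $s\stackrel{a}{\Rightarrow}s'$ means $s\stackrel{\tau}{\Rightarrow}s''\xrightarrow{a}s'''\stackrel{\tau}{\Rightarrow}s'$ for some $s'',s'''$; $s\stackrel{\alpha}{\Rightarrow}$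 means $s\stackrel{\alpha}{\Rightarrow}s'$ for some $s'$. **The language recHML.** It is the set of closed formulae generated by $\phi ::= \mathtt{tt}\mid\mathtt{ff}\mid X\mid \mathrm{Acc}\,A\mid\phi_1\vee\phi_2\mid\phi_1\wedge\phi_2\mid\langle\alpha\rangle\phi\mid[\alpha]\phi\mid\min(X,\phi)\mid\max(X,\phi)$, where $X$ ranges over a countable set $Var$ of variables, $\alpha\in Act_\tau$, $A$ is a finite subset of $Act$, and $\min(X,\cdot)$, $\max(X,\cdot)$ bind $X$. Given an environment $\rho:Var\to 2^S$: $[\![\mathtt{tt}]\!]\rho=S$; $[\![\mathtt{ff}]\!]\rho=\emptyset$; $[\![X]\!]\rho=\rho(X)$; $[\![\mathrm{Acc}\,A]\!]\rho=\{s : s\Downarrow,\text{ and } s\stackrel{\tau}{\Rightarrow}s'\text{ implies } s'\stackrel{a}{\Rightarrow}\text{ for some }a\in A\}$; $[\![\langle\alpha\rangle\phi]\!]\rho=\{s : s\stackrel{\alpha}{\Rightarrow}s'\text{ for some }s'\in[\![\phi]\!]\rho\}$; $[\![[\alpha]\phi]\!]\rho=\{s : s\Downarrow,\text{ and } s\stackrel{\alpha}{\Rightarrow}s'\text{ implies }s'\in[\![\phi]\!]\rho\}$; $\vee,\wedge$ are union and intersection; $[\![\min(X,\phi)]\!]\rho=\bigcap\{P\subseteq S : [\![\phi]\!]\rho[X\mapsto P]\subseteq P\}$; $[\![\max(X,\phi)]\!]\rho=\bigcup\{P\subseteq S : P\subseteq[\![\phi]\!]\rho[X\mapsto P]\}$.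 For closed $\phi$ the environment is omitted. **Tests.** A test is a state of an LTS $\mathcal{T}=\langle T,Act_\tau\cup\{\omega\},\to\rangle$, where $\omega\notin Act_\tau$ is a special success action. **Testing.** For a process $p$ and test $t$, the experiment $p\,|\,t$ has only $\tau$-moves: $p|t\to p'|t$ if $p\xrightarrow{\tau}p'$; $p|t\to p|t'$ if $t\xrightarrow{\tau}t'$; $p|t\to p'|t'$ if $p\xrightarrow{a}p'$ and $t\xrightarrow{a}t'$ for some $a\in Act$. A computation of $p|t$ is a maximal (finite or infinite) path $p|t\to p_1|t_1\to\cdots$ (with $p_0=p$, $t_0=t$); it is successful if $t_n\xrightarrow{\omega}$ for some $n\ge0$. $p\ \mathbf{may\ satisfy}\ t$ if there exists a successful computation of $p|t$. -}

module Defs where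

open import Level using (0ℓ; Lift) renaming (suc to lsuc)
open import Data.Bool using (if_then_else_)
open import Data.Empty.Polymorphic using (⊥)
open import Data.List using (List)
open import Data.List.Membership.Propositional using (_∈_)
open import Data.Nat using (ℕ; zero; suc; _≟_)
open import Data.Product using (Σ-syntax; ∃-syntax; _×_; _,_)
open import Data.Sum using (_⊎_)
open import Data.Unit.Polymorphic using (⊤)
open import Function.Bundles using (_↣_; _⇔_)
open import Relation.Binary.Construct.Closure.ReflexiveTransitive using (Star; ε; _◅_)
open import Relation.Binary.PropositionalEquality using (_≡_; _≢_)
open import Relation.Nullary using (¬_; does)
import Relation.Unary as U
open U using (Pred)

-- Finite sets, including the empty one, count as countable.
Countable : Set → Set
Countable A = A ↣ ℕ

Finite : {A : Set} → Pred A 0ℓ → Set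
Finite P = ∃[ xs ] (∀ x → x ∈ xs ⇔ P x)

data Action (Act : Set) : Set where
  τ   : Action Act
  ext : Act → Action Act

data TestLabel (Act : Set) : Set where
  act : Action Act → TestLabel Act
  ω   : TestLabel Act

record LTS (Label : Set) : Set₁ where
  field
    State     : Set
    countable : Countable State
    _─[_]→_   : State → Label → State → Set

  Succ : State → Pred State 0ℓ
  Succ s s′ = ∃[ α ] s ─[ α ]→ s′

  Outgoing : State → Pred (Label × State) 0ℓ
  Outgoing s (α , s′) = s ─[ α ]→ s′

  _─[_]→ : State → Label → Set
  s ─[ α ]→ = ∃[ s′ ] s ─[ α ]→ s′

FiniteBranching : {L : Set} → LTS L → Set
FiniteBranching 𝓛 = ∀ s → Finite (LTS.Succ 𝓛 s)

FinitelyManyStates : {L : Set} → LTS L → Set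
FinitelyManyStates 𝓛 = Finite {LTS.State 𝓛} U.U

FinitelyManyTransitions : {L : Set} → LTS L → Set
FinitelyManyTransitions 𝓛 = ∀ s → Finite (LTS.Outgoing 𝓛 s)

module Weak {Act : Set} (𝓛 : LTS (Action Act)) where
  open LTS 𝓛

  _⇑ : State → Set
  s ⇑ = Σ[ f ∈ (ℕ → State) ] (f 0 ≡ s × (∀ n → f n ─[ τ ]→ f (suc n)))

  _⇓ : State → Set
  s ⇓ = ¬ (s ⇑)

  _⇒τ_ : State → State → Set
  _⇒τ_ = Star (λ s s′ → s ─[ τ ]→ s′)

  _⇒[_]_ : State → Action Act → State → Set
  s ⇒[ τ ]     s′ = s ⇒τ s′
  s ⇒[ ext a ] s′ = ∃[ s₁ ] ∃[ s₂ ] (s ⇒τ s₁ × s₁ ─[ ext a ]→ s₂ × s₂ ⇒τ s′)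

  _⇒[_] : State → Action Act → Set
  s ⇒[ α ] = ∃[ s′ ] s ⇒[ α ] s′

Var : Set
Var = ℕ

-- The list in Acc stands for the finite set of its elements.
data Formula (Act : Set) : Set where
  tt ff   : Formula Act
  var     : Var → Formula Act
  Acc     : List Act → Formula Act
  _∨_ _∧_ : Formula Act → Formula Act → Formula Act
  ⟨_⟩_    : Action Act → Formula Act → Formula Act
  [_]_    : Action Act → Formula Act → Formula Act
  min max : Var → Formula Act → Formula Act

Free : {Act : Set} → Var → Formula Act → Set
Free X tt        = ⊥
Free X ff        = ⊥
Free X (var Y)   = X ≡ Y
Free X (Acc A)   = ⊥
Free X (φ ∨ ψ)   = Free X φ ⊎ Free X ψ
Free X (φ ∧ ψ)   = Free X φ ⊎ Free X ψ
Free X (⟨ α ⟩ φ) = Free X φ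
Free X ([ α ] φ) = Free X φ
Free X (min Y φ) = X ≢ Y × Free X φ
Free X (max Y φ) = X ≢ Y × Free X φ

Closed : {Act : Set} → Formula Act → Set
Closed φ = ∀ X → ¬ Free X φ

-- The subsets of S are the predicates in Pred State 0ℓ. Quantifying over
-- them in min and max puts the semantics one universe higher. Under excluded
-- middle every predicate in Set₁ is equivalent to one in Set, so the
-- quantification then really ranges over all subsets.
module Semantics {Act : Set} (𝓛 : LTS (Action Act)) where
  open LTS 𝓛
  open Weak 𝓛

  Env : Set₁
  Env = Var → Pred State 0ℓ

  _[_↦_] : Env → Var → Pred State 0ℓ → Env
  (ρ [ X ↦ P ]) Y = if does (X ≟ Y) then P else ρ Y

  ⟦_⟧ : Formula Act → Env → Pred State (lsuc 0ℓ)
  ⟦ tt ⟧      ρ s = ⊤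
  ⟦ ff ⟧      ρ s = ⊥
  ⟦ var X ⟧   ρ s = Lift (lsuc 0ℓ) (ρ X s)
  ⟦ Acc A ⟧   ρ s = Lift (lsuc 0ℓ)
    (s ⇓ × (∀ s′ → s ⇒[ τ ] s′ → ∃[ a ] (a ∈ A × s′ ⇒[ ext a ])))
  ⟦ φ ∨ ψ ⟧   ρ s = ⟦ φ ⟧ ρ s ⊎ ⟦ ψ ⟧ ρ s
  ⟦ φ ∧ ψ ⟧   ρ s = ⟦ φ ⟧ ρ s × ⟦ ψ ⟧ ρ s
  ⟦ ⟨ α ⟩ φ ⟧ ρ s = ∃[ s′ ] (s ⇒[ α ] s′ × ⟦ φ ⟧ ρ s′)
  ⟦ [ α ] φ ⟧ ρ s = s ⇓ × (∀ s′ → s ⇒[ α ] s′ → ⟦ φ ⟧ ρ s′)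
  ⟦ min X φ ⟧ ρ s = ∀ (P : Pred State 0ℓ) → ⟦ φ ⟧ (ρ [ X ↦ P ]) U.⊆ P → P s
  ⟦ max X φ ⟧ ρ s = ∃[ P ] (P U.⊆ ⟦ φ ⟧ (ρ [ X ↦ P ]) × P s)

module Testing {Act : Set} (𝓛 : LTS (Action Act)) (𝓣 : LTS (TestLabel Act)) where
  open LTS 𝓛 using () renaming (State to S; _─[_]→_ to _─[_]→ₚ_)
  open LTS 𝓣 using () renaming (State to T; _─[_]→_ to _─[_]→ₜ_; _─[_]→ to _─[_]→ₜ)

  Experiment : Set
  Experiment = S × T

  data _⟶_ : Experiment → Experiment → Set where
    process : ∀ {p p′ t} → p ─[ τ ]→ₚ p′ → (p , t) ⟶ (p′ , t)
    test    : ∀ {p t t′} → t ─[ act τ ]→ₜ t′ → (p , t) ⟶ (p , t′)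
    sync    : ∀ {p p′ t t′} a → p ─[ ext a ]→ₚ p′ → t ─[ act (ext a) ]→ₜ t′ →
              (p , t) ⟶ (p′ , t′)

  -- Maximal paths: the finite ones end in an experiment without moves.
  data Computation (e : Experiment) : Set where
    finite   : ∀ {e′} → Star _⟶_ e e′ → ¬ (∃[ e″ ] e′ ⟶ e″) → Computation e
    infinite : (f : ℕ → Experiment) → f 0 ≡ e → (∀ n → f n ⟶ f (suc n)) → Computation e

  data _Visits_ : ∀ {e e′} → Star _⟶_ e e′ → Experiment → Set where
    here  : ∀ {e e′} {π : Star _⟶_ e e′} → π Visits e
    there : ∀ {e e₁ e′ d} {m : e ⟶ e₁} {π : Star _⟶_ e₁ e′} →
            π Visits d → (m ◅ π) Visits d

  Success : Experiment → Set
  Success (p , t) = t ─[ ω ]→ₜ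

  Successful : ∀ {e} → Computation e → Set
  Successful (finite π _)     = ∃[ d ] (π Visits d × Success d)
  Successful (infinite f _ _) = ∃[ n ] Success (f n)

  _MaySatisfy_ : S → T → Set
  p MaySatisfy t = ∃[ c ] Successful {p , t} c

  -- The denotation of a closed formula does not depend on the environment ρ.
  MayRepresentable : T → Set₁
  MayRepresentable t =
    ∃[ φ ] (Closed φ × (∀ ρ p → p MaySatisfy t ⇔ Semantics.⟦_⟧ 𝓛 φ ρ p))

{-# OPTIONS --safe #-}

-- p may satisfy t iff some reachable experiment is successful, since every path
-- extends to a maximal one. Reachability is the least solution of
--   X_t = tt                               if t ─[ ω ]→,
--   X_t = ⋁ X_t′ ∨ ⋁ ⟨ a ⟩ X_t′            over t ─[ τ ]→ t′ and t ─[ a ]→ t′,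
-- a finite system, which nested least fixed points solve: unfold X_t under
-- min X_t and keep X_t as a variable below it.

module Submission where

open import Defs
open import Level using (Level; 0ℓ; suc; lift; lower)
open import Axiom.ExcludedMiddle using (ExcludedMiddle)
open import Data.Empty using (⊥-elim)
open import Data.List using (List; []; _∷_; foldr; filter; length; map)
open import Data.List.Membership.Propositional using (_∈_; _∉_; lose; find)
open import Data.List.Membership.Propositional.Properties using (∈-filter⁺; ∈-filter⁻)
open import Data.List.Properties using (filter-notAll)
open import Data.List.Relation.Unary.Any using (Any; here; there)
open import Data.List.Relation.Unary.Any.Properties using (map⁺; map⁻)
import Data.List.Membership.DecPropositional as DecMembership
open import Data.Nat as ℕ using (ℕ; zero; _≤_; s≤s⁻¹)
open import Data.Nat.Properties using (≤-trans; ≤-refl)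
open import Data.Product using (∃-syntax; _×_; _,_; proj₁; proj₂)
open import Data.Sum using (inj₁; inj₂)
open import Function using (_∘_)
open import Function.Bundles using (_⇔_; mk⇔; module Equivalence; module Injection)
open import Relation.Binary.Construct.Closure.ReflexiveTransitive using (Star; ε; _◅_; _◅◅_; gmap)
open import Relation.Binary.Definitions using (DecidableEquality)
open import Relation.Binary.PropositionalEquality using (_≡_; _≢_; refl; sym; subst)
open import Relation.Nullary using (¬_; yes; no; ¬?)
open import Relation.Nullary.Decidable using (via-injection; map′; dec-true; dec-false)
open import Relation.Unary using (Pred)

open Equivalence using (to; from)

lowerEM : ExcludedMiddle (suc 0ℓ) → ExcludedMiddle 0ℓ
lowerEM em = map′ lower (lift {ℓ = suc 0ℓ}) em

-- Finite disjunctions and updated environments.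

module _ {Act : Set} where

  ⋁ : List (Formula Act) → Formula Act
  ⋁ = foldr _∨_ ff

  Free-⋁ : ∀ {X} φs → Free X (⋁ φs) → Any (Free X) φs
  Free-⋁ (φ ∷ φs) (inj₁ x) = here x
  Free-⋁ (φ ∷ φs) (inj₂ x) = there (Free-⋁ φs x)

module _ {Act : Set} (𝓛 : LTS (Action Act)) where
  open LTS 𝓛
  open Semantics 𝓛

  ⟦⋁⟧⁺ : ∀ {ρ p φs} → Any (λ φ → ⟦ φ ⟧ ρ p) φs → ⟦ ⋁ φs ⟧ ρ p
  ⟦⋁⟧⁺ (here x)  = inj₁ x
  ⟦⋁⟧⁺ (there x) = inj₂ (⟦⋁⟧⁺ x)

  ⟦⋁⟧⁻ : ∀ {ρ p} φs → ⟦ ⋁ φs ⟧ ρ p → Any (λ φ → ⟦ φ ⟧ ρ p) φs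
  ⟦⋁⟧⁻ (φ ∷ φs) (inj₁ x) = here x
  ⟦⋁⟧⁻ (φ ∷ φs) (inj₂ x) = there (⟦⋁⟧⁻ φs x)

  ↦-same : ∀ (ρ : Env) X P → (ρ [ X ↦ P ]) X ≡ P
  ↦-same ρ X P rewrite dec-true (X ℕ.≟ X) refl = refl

  ↦-other : ∀ (ρ : Env) {X Y} P → X ≢ Y → (ρ [ X ↦ P ]) Y ≡ ρ Y
  ↦-other ρ {X} {Y} P X≢Y rewrite dec-false (X ℕ.≟ Y) X≢Y = refl

-- Maximal paths and reachable success.

module Maximality {Act : Set} (𝓛 : LTS (Action Act)) (𝓣 : LTS (TestLabel Act)) where
  open Testing 𝓛 𝓣

  CanSucceed : Experiment → Set
  CanSucceed e = ∃[ d ] (Star _⟶_ e d × Success d)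

  visited-reachable : ∀ {e e′ d} {π : Star _⟶_ e e′} → π Visits d → Star _⟶_ e d
  visited-reachable here              = ε
  visited-reachable (there {m = m} v) = m ◅ visited-reachable v

  prefix : (f : ℕ → Experiment) → (∀ n → f n ⟶ f (ℕ.suc n)) → ∀ n → Star _⟶_ (f 0) (f n)
  prefix f steps zero      = ε
  prefix f steps (ℕ.suc n) = prefix f steps n ◅◅ steps n ◅ ε

  successful⇒canSucceed : ∀ {e} (c : Computation e) → Successful c → CanSucceed e
  successful⇒canSucceed (finite π _)            (d , v , s) = d , visited-reachable v , s
  successful⇒canSucceed (infinite f refl steps) (n , s)     = f n , prefix f steps n , s

  -- If no stuck experiment is reachable, every reachable one has a move, and repeatedly choosing
  -- one yields an infinite path.
  maximal : ExcludedMiddle 0ℓ → ∀ e → Computation e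
  maximal em e with em {∃[ e′ ] (Star _⟶_ e e′ × ¬ (∃[ e″ ] e′ ⟶ e″))}
  ... | yes (_ , π , stuck) = finite π stuck
  ... | no neverStuck       = infinite (proj₁ ∘ run) refl (proj₂ ∘ move ∘ run)
    where
    Reachable : Set
    Reachable = ∃[ e′ ] Star _⟶_ e e′

    move : (r : Reachable) → ∃[ e″ ] proj₁ r ⟶ e″
    move (e′ , π) with em {∃[ e″ ] e′ ⟶ e″}
    ... | yes m    = m
    ... | no stuck = ⊥-elim (neverStuck (e′ , π , stuck))

    run : ℕ → Reachable
    run zero      = e , ε
    run (ℕ.suc n) = let r = run n in proj₁ (move r) , proj₂ r ◅◅ proj₂ (move r) ◅ ε

  success-here : ∀ {e} → Success e → (c : Computation e) → Successful c
  success-here s (finite π _)        = _ , here , s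
  success-here s (infinite f refl _) = 0 , s

  prepend : ∀ {e e₁} → e ⟶ e₁ → ∃[ c ] Successful {e₁} c → ∃[ c ] Successful {e} c
  prepend m (finite π stuck , d , v , s) = finite (m ◅ π) stuck , d , there v , s
  prepend {e} m (infinite f refl steps , n , s) = infinite f′ refl steps′ , ℕ.suc n , s
    where
    f′ : ℕ → Experiment
    f′ zero      = e
    f′ (ℕ.suc k) = f k

    steps′ : ∀ k → f′ k ⟶ f′ (ℕ.suc k)
    steps′ zero      = m
    steps′ (ℕ.suc k) = steps k

  -- The path is extended to a maximal one only beyond its last experiment, where success has
  -- already occurred.
  canSucceed⇒successful : ExcludedMiddle 0ℓ → ∀ {e} → CanSucceed e → ∃[ c ] Successful {e} c
  canSucceed⇒successful em (d , ε , s)     = maximal em d , success-here s (maximal em d)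
  canSucceed⇒successful em (d , m ◅ π , s) = prepend m (canSucceed⇒successful em (d , π , s))

-- The formula of a test and its free variables.

module Characteristic {Act : Set} (𝓛 : LTS (Action Act)) (𝓣 : LTS (TestLabel Act))
                      (outgoing : FinitelyManyTransitions 𝓣) where
  open LTS 𝓛 using () renaming (State to S)
  open LTS 𝓣 using () renaming (State to T; countable to T↣ℕ; _─[_]→_ to _─[_]→ₜ_; _─[_]→ to _─[_]→ₜ)
  open Weak 𝓛
  open Semantics 𝓛
  open Testing 𝓛 𝓣
  open Maximality 𝓛 𝓣
  open Injection T↣ℕ using () renaming (to to index; injective to index-injective)

  _≟_ : DecidableEquality T
  _≟_ = via-injection T↣ℕ ℕ._≟_

  open DecMembership _≟_ using (_∈?_)

  _∖_ : List T → T → List T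
  R ∖ t = filter (λ u → ¬? (u ≟ t)) R

  length-∖ : ∀ {R t} → t ∈ R → length (R ∖ t) ℕ.< length R
  length-∖ {R} t∈R = filter-notAll _ R (lose t∈R (λ ¬t≡t → ¬t≡t refl))

  ∈-∖⁺ : ∀ {R t u} → u ∈ R → u ≢ t → u ∈ R ∖ t
  ∈-∖⁺ = ∈-filter⁺ _

  ∈-∖⁻ : ∀ {R t u} → u ∈ R ∖ t → u ∈ R × u ≢ t
  ∈-∖⁻ = ∈-filter⁻ _

  ∉-∖⁻ : ∀ {R t u} → u ∉ R ∖ t → u ≢ t → u ∉ R
  ∉-∖⁻ u∉ u≢t u∈R = u∉ (∈-∖⁺ u∈R u≢t)

  transitions : T → List (TestLabel Act × T)
  transitions t = proj₁ (outgoing t)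

  ∈-transitions : ∀ t l → l ∈ transitions t ⇔ LTS.Outgoing 𝓣 t l
  ∈-transitions t = proj₂ (outgoing t)

  -- An ω-transition contributes `tt`, which makes the whole disjunction true; this replaces a case
  -- split on success.
  summand : (T → Formula Act) → TestLabel Act × T → Formula Act
  summand φ (ω           , t′) = tt
  summand φ (act τ       , t′) = φ t′
  summand φ (act (ext a) , t′) = ⟨ ext a ⟩ φ t′

  body : (T → Formula Act) → T → Formula Act
  body φ t = ⋁ (map (summand φ) (transitions t))

  -- The fuel n bounds the length of R, the list of states whose variable is
  -- not yet bound; the case n = 0 is therefore the same as t ∉ R.
  formula : ℕ → List T → T → Formula Act
  formula zero      R t = var (index t)
  formula (ℕ.suc n) R t with t ∈? R
  ... | yes _ = min (index t) (body (formula n (R ∖ t)) t)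
  ... | no  _ = var (index t)

  Free-summand : ∀ {X} φ l → Free X (summand φ l) → ∃[ t ] Free X (φ t)
  Free-summand φ (act τ       , t′) x = t′ , x
  Free-summand φ (act (ext a) , t′) x = t′ , x

  Free-body : ∀ {X} φ t → Free X (body φ t) → ∃[ t′ ] Free X (φ t′)
  Free-body φ t x =
    let l , _ , y = find (map⁻ (Free-⋁ (map (summand φ) (transitions t)) x)) in Free-summand φ l y

  ∉-exhausted : ∀ {R} {t : T} → length R ≤ 0 → t ∉ R
  ∉-exhausted {[]} _ ()

  shrink : ∀ {n R t} → length R ≤ ℕ.suc n → t ∈ R → length (R ∖ t) ≤ n
  shrink R≤ t∈R = s≤s⁻¹ (≤-trans (length-∖ t∈R) R≤)

  -- Every state taken out of `R` has its variable bound by the `min` that takes it out. With all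
  -- states in `R`, this gives closedness.
  Free-formula : ∀ n R t {X} → length R ≤ n → Free X (formula n R t) → ∃[ u ] (u ∉ R × X ≡ index u)
  Free-formula zero      R t R≤ x = t , ∉-exhausted R≤ , x
  Free-formula (ℕ.suc n) R t R≤ x with t ∈? R
  ... | no t∉R = t , t∉R , x
  ... | yes t∈R with Free-body (formula n (R ∖ t)) t (proj₂ x)
  ...   | t′ , y with Free-formula n (R ∖ t) t′ (shrink R≤ t∈R) y
  -- `min` excludes `index t`, so `u` differs from `t` and is outside `R` too.
  ...     | u , u∉ , refl = u , ∉-∖⁻ u∉ (λ { refl → proj₁ x refl }) , refl

  -- The simultaneous least fixed point.

  -- One unfolding of an equation. The level varies because `Q` may be a denotation, in `Set₁`, or
  -- an inductive predicate, in `Set`.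
  data Step {ℓ : Level} (Q : T → Pred S ℓ) (t : T) (p : S) : Set ℓ where
    success : t ─[ ω ]→ₜ → Step Q t p
    silent  : ∀ {t′} → t ─[ act τ ]→ₜ t′ → Q t′ p → Step Q t p
    visible : ∀ {a t′ p′} → t ─[ act (ext a) ]→ₜ t′ → p ⇒[ ext a ] p′ → Q t′ p′ → Step Q t p

  Step-map : ∀ {ℓ ℓ′} {Q : T → Pred S ℓ} {Q′ : T → Pred S ℓ′} →
             (∀ {t p} → Q t p → Q′ t p) → ∀ {t p} → Step Q t p → Step Q′ t p
  Step-map f (success s)     = success s
  Step-map f (silent m x)    = silent m (f x)
  Step-map f (visible m w x) = visible m w (f x)

  module _ (φ : T → Formula Act) (ρ : Env) where

    ⟦body⟧⁺ : ∀ {t p} → Step (λ t′ → ⟦ φ t′ ⟧ ρ) t p → ⟦ body φ t ⟧ ρ p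
    ⟦body⟧⁺ {t} {p} step = ⟦⋁⟧⁺ 𝓛 (map⁺ (pick step))
      where
      at : ∀ {l} → LTS.Outgoing 𝓣 t l → ⟦ summand φ l ⟧ ρ p →
           Any (λ l → ⟦ summand φ l ⟧ ρ p) (transitions t)
      at {l} m = lose (from (∈-transitions t l) m)

      pick : Step (λ t′ → ⟦ φ t′ ⟧ ρ) t p → Any (λ l → ⟦ summand φ l ⟧ ρ p) (transitions t)
      pick (success (t′ , m)) = at m _
      pick (silent m x)       = at m x
      pick (visible m w x)    = at m (_ , w , x)

    ⟦body⟧⁻ : ∀ {t p} → ⟦ body φ t ⟧ ρ p → Step (λ t′ → ⟦ φ t′ ⟧ ρ) t p
    ⟦body⟧⁻ {t} x with find (map⁻ (⟦⋁⟧⁻ 𝓛 (map (summand φ) (transitions t)) x))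
    ... | l@(ω           , t′) , l∈ , _           = success (t′ , to (∈-transitions t l) l∈)
    ... | l@(act τ       , t′) , l∈ , y           = silent (to (∈-transitions t l) l∈) y
    ... | l@(act (ext a) , t′) , l∈ , (_ , w , y) = visible (to (∈-transitions t l) l∈) w y

  -- The least solution of the equations for `R`, other variables being read from `ρ`. As it lives
  -- in `Set`, it can instantiate the `P` in the semantics of `min`.
  data May (R : List T) (ρ : Env) (t : T) (p : S) : Set where
    stop : t ∉ R → ρ (index t) p → May R ρ t p
    go   : t ∈ R → Step (May R ρ) t p → May R ρ t p

  module _ {ℓ} {R : List T} {ρ : Env} {Q : T → Pred S ℓ}
           (q-stop : ∀ {t p} → t ∉ R → ρ (index t) p → Q t p)
           (q-go   : ∀ {t p} → t ∈ R → Step Q t p → Q t p) where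

    mutual
      May-fold : ∀ {t p} → May R ρ t p → Q t p
      May-fold (stop t∉R x)    = q-stop t∉R x
      May-fold (go   t∈R step) = q-go t∈R (Step-fold step)

      -- `Step-map May-fold` written out, so that recursion is visibly on subterms.
      Step-fold : ∀ {t p} → Step (May R ρ) t p → Step Q t p
      Step-fold (success s)     = success s
      Step-fold (silent m x)    = silent m (May-fold x)
      Step-fold (visible m w x) = visible m w (May-fold x)

  -- Together, the next two lemmas are the nontrivial half of Bekić's principle:
  -- the component of t in a simultaneous least fixed point is the least fixed
  -- point in the variable of t alone, the other components being solved inside.
  May-unbind : ∀ {R ρ t} → t ∈ R → ∀ {u p} →
               May (R ∖ t) (ρ [ index t ↦ May R ρ t ]) u p → May R ρ u p
  May-unbind {R} {ρ} {t} t∈R = May-fold stop′ (λ u∈ → go (proj₁ (∈-∖⁻ u∈)))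
    where
    stop′ : ∀ {u p} → u ∉ R ∖ t → (ρ [ index t ↦ May R ρ t ]) (index u) p → May R ρ u p
    -- Either `u` is `t`, whose variable holds `May R ρ t`, or `u` is outside `R` and the update
    -- does not affect it.
    stop′ {u} {p} u∉ x with u ≟ t
    ... | yes refl = subst (λ P → P p) (↦-same 𝓛 ρ (index t) (May R ρ t)) x
    ... | no  u≢t  = stop (∉-∖⁻ u∉ u≢t)
                       (subst (λ P → P p) (↦-other 𝓛 ρ (May R ρ t) (u≢t ∘ sym ∘ index-injective)) x)

  May-bind : ∀ {R ρ t} {P : Pred S 0ℓ} → t ∈ R →
             (∀ {p} → Step (May (R ∖ t) (ρ [ index t ↦ P ])) t p → P p) →
             ∀ {u p} → May R ρ u p → May (R ∖ t) (ρ [ index t ↦ P ]) u p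
  May-bind {R} {ρ} {t} {P} t∈R prefixed = May-fold stop′ go′
    where
    stop′ : ∀ {u p} → u ∉ R → ρ (index u) p → May (R ∖ t) (ρ [ index t ↦ P ]) u p
    stop′ {u} {p} u∉R x = stop (u∉R ∘ proj₁ ∘ ∈-∖⁻)
      (subst (λ P → P p) (sym (↦-other 𝓛 ρ P λ eq → u∉R (subst (_∈ R) (index-injective eq) t∈R))) x)

    go′ : ∀ {u p} → u ∈ R → Step (May (R ∖ t) (ρ [ index t ↦ P ])) u p →
          May (R ∖ t) (ρ [ index t ↦ P ]) u p
    -- At `t` the derivation must now stop at a variable with value `P`, and `prefixed` supplies
    -- that value.
    go′ {u} {p} u∈R step with u ≟ t
    ... | yes refl = stop (λ u∈ → proj₂ (∈-∖⁻ {R} u∈) refl)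
                       (subst (λ P → P p) (sym (↦-same 𝓛 ρ (index t) P)) (prefixed step))
    ... | no  u≢t  = go (∈-∖⁺ u∈R u≢t) step

  mutual
    formula-sound : ∀ n R t {ρ p} → length R ≤ n → ⟦ formula n R t ⟧ ρ p → May R ρ t p
    formula-sound zero      R t R≤ (lift x) = stop (∉-exhausted R≤) x
    formula-sound (ℕ.suc n) R t {ρ} R≤ x with t ∈? R
    ... | no  t∉R = stop t∉R (lower x)
    -- `May R ρ t` is a pre-fixed point of the body: the induction hypothesis leads to the smaller
    -- system, and `May-unbind` back to `R`.
    ... | yes t∈R = x (May R ρ t) λ y → go t∈R
            (Step-map (May-unbind t∈R ∘ formula-sound n (R ∖ t) _ (shrink R≤ t∈R))
                      (⟦body⟧⁻ (formula n (R ∖ t)) _ y))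

    formula-complete : ∀ n R t {ρ p} → length R ≤ n → May R ρ t p → ⟦ formula n R t ⟧ ρ p
    formula-complete zero      R t R≤ (stop _ x)   = lift x
    formula-complete zero      R t R≤ (go t∈R _)   = ⊥-elim (∉-exhausted R≤ t∈R)
    formula-complete (ℕ.suc n) R t {ρ} R≤ x with t ∈? R | x
    ... | no  t∉R | stop _ y      = lift y
    ... | no  t∉R | go t∈R _      = ⊥-elim (t∉R t∈R)
    ... | yes t∈R | stop t∉R _    = ⊥-elim (t∉R t∈R)
    -- For any pre-fixed point `P`, the induction hypothesis turns `body⊆P` into the closure
    -- condition that `May-bind` requires.
    ... | yes t∈R | go _ step     = λ P body⊆P →
            let prefixed : ∀ {p} → Step (May (R ∖ t) (ρ [ index t ↦ P ])) t p → P p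
                prefixed s = body⊆P (⟦body⟧⁺ (formula n (R ∖ t)) _
                  (Step-map (formula-complete n (R ∖ t) _ (shrink R≤ t∈R)) s))
            in prefixed (Step-map (May-bind t∈R prefixed) step)

  -- The least fixed point as reachability of success.

  module _ {R : List T} (all∈R : ∀ t → t ∈ R) where

    May⇒canSucceed : ∀ {ρ t p} → May R ρ t p → CanSucceed (p , t)
    May⇒canSucceed = May-fold (λ {t} t∉R _ → ⊥-elim (t∉R (all∈R t))) (λ _ → extend)
      where
      extend : ∀ {t p} → Step (λ t p → CanSucceed (p , t)) t p → CanSucceed (p , t)
      extend (success s)                           = _ , ε , s
      extend (silent m (d , π , s))                = d , test m ◅ π , s
      extend (visible {a} m (_ , _ , w , n , w′) (d , π , s)) =
        d , gmap (_, _) process w ◅◅ sync a n m ◅ gmap (_, _) process w′ ◅◅ π , s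

    -- The τ-moves of the process pile up in w until the next synchronisation
    -- absorbs them into a weak transition.
    reachable⇒May : ∀ {ρ t p q d} → q ⇒τ p → Star _⟶_ (p , t) d → Success d → May R ρ t q
    reachable⇒May w ε                s = go (all∈R _) (success s)
    reachable⇒May w (process n ◅ π)  s = reachable⇒May (w ◅◅ n ◅ ε) π s
    reachable⇒May w (test m ◅ π)     s = go (all∈R _) (silent m (reachable⇒May w π s))
    reachable⇒May w (sync a n m ◅ π) s =
      go (all∈R _) (visible m (_ , _ , w , n , ε) (reachable⇒May ε π s))

theorem5p2 : ExcludedMiddle (suc 0ℓ) →
    (Act : Set) → Countable Act →
    (𝓛 : LTS (Action Act)) → FiniteBranching 𝓛 →
    (𝓣 : LTS (TestLabel Act)) → FinitelyManyStates 𝓣 → FinitelyManyTransitions 𝓣 →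
    (t : LTS.State 𝓣) → Testing.MayRepresentable 𝓛 𝓣 t
theorem5p2 em Act _ 𝓛 _ 𝓣 (R , R-all) outgoing t =
  -- `R` lists all states, so all variables get bound, and its length is enough fuel.
  formula (length R) R t ,
  (λ X free → let u , u∉R , _ = Free-formula (length R) R t ≤-refl free in u∉R (all∈R u)) ,
  λ ρ p → mk⇔
    (λ (c , s) → let d , π , ok = successful⇒canSucceed c s in
      formula-complete (length R) R t ≤-refl (reachable⇒May all∈R ε π ok))
    (λ x → canSucceed⇒successful (lowerEM em)
      (May⇒canSucceed all∈R (formula-sound (length R) R t ≤-refl x)))
  where
  open Maximality 𝓛 𝓣
  open Characteristic 𝓛 𝓣 outgoing

  all∈R : ∀ u → u ∈ R
  all∈R u = from (R-all u) _
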